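{- Let $S$ be a finite subset of $\mathbf{Z}^2$, viewed as a set of unit squares in the plane, and put $B=\{(i,j)\in S\mid i\equiv j\pmod 2\}$ (the black squares of $S$) and $W=S\setminus B$ (the white squares of $S$). Define $$E=\{b\in B\mid b-(0,1)\notin W\},\quad I=\{b\in B\mid b-(0,1)\in W\},\quad X=\{b\in\mathbf{Z}^2\setminus B\mid b-(0,1)\in W\}.$$ Then there is a bijection between the set of domino tilings of $S$ and the set of families of paths, using steps chosen from $\{(1,1),(0,2),(-1,1)\}$, such that each entry in $E$ is connected by some path to an exit in $X$ and vice versa, with paths passing through elements of $I$ only (that is, each path of the family starts at an element of $E$, ends at an element of $X$, and all its intermediate points are in $I$; every element of $E$ is the start of a path and every element of $X$ is the end of a path), and such that each element lies on at most one path.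
   Context: A domino tiling of $S$ is a partition of $S$ into two-element subsets $\{s,t\}$ of adjacent squares, i.e. with $s-t\in\{\pm(1,0),\pm(0,1)\}$. A path is a finite sequence of points of $\mathbf{Z}^2$ in which each difference of consecutive points is one of the allowed steps. The second coordinate is the horizontal one, so $b-(0,1)$ is the square immediately to the left of $b$; elements of $E$ ("entries"), $I$ ("interior edges") and $X$ ("exits") represent vertical edges with a white-coloured square to their left and a black-coloured square to their right, each edge being identified with the square to its right. -}

module Defs where

open import Data.Integer.Base using (ℤ; +_; -[1+_]; _-_)
open import Data.Integer.Divisibility using (_∣_)
open import Data.List.Base using (List; []; _∷_; _∷ʳ_)
open import Data.List.Membership.Propositional using () renaming (_∈_ to _∈ₗ_)
open import Data.List.Relation.Unary.All using (All)
open import Data.List.Relation.Unary.Linked using (Linked)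
open import Data.Product.Base using (_×_; _,_; ∃-syntax)
open import Data.Sum.Base using (_⊎_)
open import Function.Base using (_on_)
open import Level using (0ℓ; suc)
open import Relation.Binary.Bundles using (Setoid)
open import Relation.Binary.Core using (Rel)
open import Relation.Binary.Definitions using (_Respects_)
open import Relation.Binary.PropositionalEquality.Core using (_≡_)
import Relation.Binary.Construct.On as On
open import Relation.Unary using (Pred; _∈_; _∉_; _⊆_; _≐_; _∩_; _∖_)
open import Relation.Unary.Relation.Binary.Equality using (≐-setoid)

Point : Set
Point = ℤ × ℤ

infixl 6 _⊖_

_⊖_ : Point → Point → Point
(i , j) ⊖ (k , l) = i - k , j - l

Finite : Pred Point 0ℓ → Set
Finite S = ∃[ ps ] S ≐ (_∈ₗ ps)

adjacentOffsets : List Point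
adjacentOffsets = (+ 1 , + 0) ∷ (-[1+ 0 ] , + 0) ∷ (+ 0 , + 1) ∷ (+ 0 , -[1+ 0 ]) ∷ []

-- A two-element set {s , t} of adjacent squares.  The order of s and t, and the
-- proof of adjacency, are forgotten by the equality _≈ᵈ_ below.
record Domino : Set where
  constructor domino
  field
    s t      : Point
    adjacent : s ⊖ t ∈ₗ adjacentOffsets

squares : Domino → Pred Point 0ℓ
squares d p = p ≡ Domino.s d ⊎ p ≡ Domino.t d

infix 4 _≈ᵈ_

_≈ᵈ_ : Rel Domino 0ℓ
_≈ᵈ_ = _≐_ on squares

steps : List Point
steps = (+ 1 , + 1) ∷ (+ 0 , + 2) ∷ (-[1+ 0 ] , + 1) ∷ []

Step : Rel Point 0ℓ
Step a b = b ⊖ a ∈ₗ steps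

left : Point → Point
left b = b ⊖ (+ 0 , + 1)

module _ (S : Pred Point 0ℓ) where

  B W : Pred Point 0ℓ
  B = S ∩ λ (i , j) → + 2 ∣ i - j
  W = S ∖ B

  E I X : Pred Point 0ℓ
  E b = b ∈ B × left b ∉ W
  I b = b ∈ B × left b ∈ W
  X b = b ∉ B × left b ∈ W

  record Tiling : Set (suc 0ℓ) where
    field
      dominoes : Pred Domino 0ℓ
      respects : dominoes Respects _≈ᵈ_
      inside   : ∀ d → d ∈ dominoes → squares d ⊆ S
      covers   : ∀ p → p ∈ S → ∃[ d ] d ∈ dominoes × p ∈ squares d
      disjoint : ∀ d d′ p → d ∈ dominoes → d′ ∈ dominoes →
                 p ∈ squares d → p ∈ squares d′ → d ≈ᵈ d′

  -- The sequence of points e , m₁ , … , mₖ , x (with k ≥ 0).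
  record IsPath (path : List Point) : Set where
    field
      start        : Point
      intermediate : List Point
      end          : Point
      shape        : path ≡ start ∷ (intermediate ∷ʳ end)
      start∈E      : start ∈ E
      all∈I        : All I intermediate
      end∈X        : end ∈ X
      linked       : Linked Step path

  -- A set of paths; as E and X are disjoint, no path consists of one point only.
  record PathFamily : Set (suc 0ℓ) where
    field
      paths     : Pred (List Point) 0ℓ
      isPath    : ∀ ps → ps ∈ paths → IsPath ps
      entries   : ∀ e → e ∈ E → ∃[ ps ] e ∷ ps ∈ paths
      exits     : ∀ x → x ∈ X → ∃[ ps ] ps ∷ʳ x ∈ paths
      atMostOne : ∀ p ps qs → ps ∈ paths → qs ∈ paths →
                  p ∈ₗ ps → p ∈ₗ qs → ps ≡ qs

  -- Tilings are compared as sets of dominoes, families as sets of paths.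
  tilings : Setoid (suc 0ℓ) 0ℓ
  tilings = On.setoid (≐-setoid Domino 0ℓ) Tiling.dominoes

  pathFamilies : Setoid (suc 0ℓ) 0ℓ
  pathFamilies = On.setoid (≐-setoid (List Point) 0ℓ) PathFamily.paths

{-# OPTIONS --safe #-}
module Submission where

-- Let a tiling send each black square a whose domino {a , w} is not of the form
-- {a , left a} to the square b with left b = w.  Then b ⊖ a is an allowed step,
-- and a ↦ b is injective; steps increase the column, so chains of arrows are
-- finite.  A black square is the source of an arrow unless it is paired with its
-- left neighbour, and then it is not a target either; so the maximal chains of
-- arrows run from E to X.  Conversely, a family of paths pairs each non-final
-- point a of a path with left b for its successor b, and each black a on no path
-- with left a.  In either direction one inclusion between the original object and
-- its round trip is enough: two tilings, or two families, one of which contains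
-- the other are equal.

open import Defs
open import Data.Fin.Induction using (spo-wellFounded)
open import Data.Integer.Base using (ℤ; +_; -[1+_]; _+_; _-_; _*_; -_; ∣_∣; _<_; +<+)
open import Data.Integer.DivMod using (a≡a%ℕn+[a/ℕn]*n; n%ℕd<d; _%ℕ_; _/ℕ_)
open import Data.Integer.Divisibility using (_∣_)
open import Data.Integer.Divisibility.Signed as Signed
  using (divides; ∣ᵤ⇒∣; ∣⇒∣ᵤ) renaming (_∣_ to _∣ₛ_)
open import Data.Integer.Properties as ℤ
  using (<-isStrictPartialOrder; <-trans; <-irrefl; +-monoʳ-<)
open import Data.Integer.Tactic.RingSolver using (solve-∀)
open import Data.List.Base using (List; []; _∷_; _∷ʳ_; lookup; map)
open import Data.List.Membership.Propositional using (find; lose) renaming (_∈_ to _∈ₗ_)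
open import Data.List.Membership.Propositional.Properties using (∈-map⁺)
import Data.List.Membership.DecPropositional as DecMembership
open import Data.List.Relation.Binary.Subset.Propositional using () renaming (_⊆_ to _⊆ₗ_)
open import Data.List.Relation.Unary.All as All using (All; []; _∷_)
import Data.List.Relation.Unary.All.Properties as All
open import Data.List.Relation.Unary.AllPairs using ([]; _∷_)
import Data.List.Relation.Unary.AllPairs as AllPairs
open import Data.List.Relation.Unary.Any using (Any; here; there; any?; index)
open import Data.List.Relation.Unary.Any.Properties using (lookup-index; ++⁺ʳ)
open import Data.List.Relation.Unary.Linked as Linked using (Linked; []; [-]; _∷_)
open import Data.List.Relation.Unary.Linked.Properties using (Linked⇒AllPairs)
open import Data.List.Relation.Unary.Unique.Propositional using (Unique)
open import Data.Nat.Base as ℕ using (s≤s; z≤n)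
import Data.Nat.Divisibility as ℕ
open import Data.Product.Base using (_×_; _,_; ∃-syntax; proj₁; proj₂)
open import Data.Product.Properties using (≡-dec)
open import Data.Sum.Base using (_⊎_; inj₁; inj₂; [_,_]′)
open import Function.Base using (_∘_; _on_)
open import Function.Bundles using (Bijection)
open import Function.Consequences.Setoid
  using (strictlyInverseˡ⇒inverseˡ; strictlyInverseʳ⇒inverseʳ)
open import Function.Properties.Inverse using (Inverse⇒Bijection)
open import Induction.WellFounded using (Acc; acc; WellFounded)
open import Level using (0ℓ)
open import Relation.Binary.Bundles using (Setoid)
open import Relation.Binary.Core using (Rel)
open import Relation.Binary.Definitions using (DecidableEquality)
open import Relation.Binary.PropositionalEquality
  using (_≡_; _≢_; refl; sym; trans; cong; cong₂; subst; subst₂)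
open import Relation.Binary.Structures using (IsStrictPartialOrder)
import Relation.Binary.Construct.On as On
import Relation.Binary.Construct.Flip.EqAndOrd as Flip
open import Relation.Nullary using (¬_; Dec; yes; no; contradiction)
open import Relation.Nullary.Decidable using (map′; _×-dec_; ¬?)
open import Relation.Unary using (Pred; Decidable; _∈_; _∉_; _⊆_)

-- Consecutive entries of a list

data Consecutive {A : Set} (a b : A) : List A → Set where
  here  : ∀ {xs} → Consecutive a b (a ∷ b ∷ xs)
  there : ∀ {x xs} → Consecutive a b xs → Consecutive a b (x ∷ xs)

module _ {A : Set} where

  private
    variable
      a a′ b b′ x y : A
      xs ys : List A

  consecutive⇒∈ˡ : Consecutive a b xs → a ∈ₗ xs
  consecutive⇒∈ˡ here      = here refl
  consecutive⇒∈ˡ (there c) = there (consecutive⇒∈ˡ c)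

  consecutive⇒∈-tail : Consecutive a b (x ∷ xs) → b ∈ₗ xs
  consecutive⇒∈-tail here              = here refl
  consecutive⇒∈-tail (there {xs = _ ∷ _} c) = there (consecutive⇒∈-tail c)

  consecutive⇒∈ʳ : Consecutive a b xs → b ∈ₗ xs
  consecutive⇒∈ʳ {xs = _ ∷ _} c = there (consecutive⇒∈-tail c)

  consecutive⇒∈-init : ∀ xs → Consecutive a b (xs ∷ʳ x) → a ∈ₗ xs
  consecutive⇒∈-init []           (there ())
  consecutive⇒∈-init (_ ∷ [])     here      = here refl
  consecutive⇒∈-init (_ ∷ _ ∷ _)  here      = here refl
  consecutive⇒∈-init (_ ∷ xs)     (there c) = there (consecutive⇒∈-init xs c)

  successor : ∀ xs → a ∈ₗ (xs ∷ʳ x) → a ≡ x ⊎ ∃[ b ] Consecutive a b (xs ∷ʳ x)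
  successor []           (here refl) = inj₁ refl
  successor (_ ∷ [])     (here refl) = inj₂ (_ , here)
  successor (_ ∷ _ ∷ _)  (here refl) = inj₂ (_ , here)
  successor (_ ∷ xs)     (there a∈)  with successor xs a∈
  ... | inj₁ a≡x     = inj₁ a≡x
  ... | inj₂ (b , c) = inj₂ (b , there c)

  predecessor : b ∈ₗ (x ∷ xs) → b ≡ x ⊎ ∃[ a ] Consecutive a b (x ∷ xs)
  predecessor               (here b≡x) = inj₁ b≡x
  predecessor {xs = _ ∷ _} (there b∈)  with predecessor b∈
  ... | inj₁ refl    = inj₂ (_ , here)
  ... | inj₂ (a , c) = inj₂ (a , there c)

  consecutive-functional : Unique xs → Consecutive a b xs → Consecutive a b′ xs → b ≡ b′
  consecutive-functional _         here      here       = refl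
  consecutive-functional (a≢ ∷ _)  here      (there c′) =
    contradiction refl (All.lookup a≢ (consecutive⇒∈ˡ c′))
  consecutive-functional (a≢ ∷ _)  (there c) here       =
    contradiction refl (All.lookup a≢ (consecutive⇒∈ˡ c))
  consecutive-functional (_ ∷ uxs) (there c) (there c′) = consecutive-functional uxs c c′

  consecutive-injective : Unique xs → Consecutive a b xs → Consecutive a′ b xs → a ≡ a′
  consecutive-injective _              here      here       = refl
  consecutive-injective (_ ∷ (b≢ ∷ _)) here      (there c′) =
    contradiction refl (All.lookup b≢ (consecutive⇒∈-tail c′))
  consecutive-injective (_ ∷ (b≢ ∷ _)) (there c) here       =
    contradiction refl (All.lookup b≢ (consecutive⇒∈-tail c))
  consecutive-injective (_ ∷ uxs)      (there c) (there c′) = consecutive-injective uxs c c′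

  module _ {R : Rel A 0ℓ} where

    linked⇒consecutive : Linked R xs → Consecutive a b xs → R a b
    linked⇒consecutive (Rab ∷ _) here      = Rab
    linked⇒consecutive [-]       (there ())
    linked⇒consecutive (_ ∷ Rxs) (there c) = linked⇒consecutive Rxs c

    consecutive⇒linked : ∀ xs → (∀ {a b} → Consecutive a b xs → R a b) → Linked R xs
    consecutive⇒linked []           f = []
    consecutive⇒linked (_ ∷ [])     f = [-]
    consecutive⇒linked (_ ∷ y ∷ xs) f = f here ∷ consecutive⇒linked (y ∷ xs) (f ∘ there)

    -- Walk back from the common point: predecessors are unique, and the start of
    -- the second chain has none.
    head∈chain : (∀ {a a′ b} → R a b → R a′ b → a ≡ a′) → (∀ {a} → ¬ R a y) →
                 Linked R (x ∷ xs) → Linked R (y ∷ ys) →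
                 b ∈ₗ (x ∷ xs) → b ∈ₗ (y ∷ ys) → x ∈ₗ (y ∷ ys)
    head∈chain inj ¬Ry _           Rys (here refl) b∈ys = b∈ys
    head∈chain inj ¬Ry (Rxz ∷ Rxs) Rys (there b∈)  b∈ys
      with predecessor (head∈chain inj ¬Ry Rxs Rys b∈ b∈ys)
    ... | inj₁ refl    = contradiction Rxz ¬Ry
    ... | inj₂ (a , c) with inj Rxz (linked⇒consecutive Rys c)
    ...   | refl = consecutive⇒∈ˡ c

    maximal-chain-unique : (∀ {a b b′} → R a b → R a b′ → b ≡ b′) →
      (∀ {b} → ¬ R x b) → (∀ {b} → ¬ R y b) → ∀ xs ys →
      Linked R (a ∷ xs ∷ʳ x) → Linked R (a ∷ ys ∷ʳ y) → xs ∷ʳ x ≡ ys ∷ʳ y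
    maximal-chain-unique fun ¬Rx ¬Ry [] [] (Rax ∷ _) (Ray ∷ _) = cong (_∷ []) (fun Rax Ray)
    maximal-chain-unique fun ¬Rx ¬Ry [] (_ ∷ ys) (Rax ∷ _) (Rac ∷ Rys) with fun Rax Rac
    ... | refl with ys  | Rys
    ...   | []    | Rxb ∷ _ = contradiction Rxb ¬Rx
    ...   | _ ∷ _ | Rxb ∷ _ = contradiction Rxb ¬Rx
    maximal-chain-unique fun ¬Rx ¬Ry (_ ∷ xs) [] (Rac ∷ Rxs) (Ray ∷ _) with fun Ray Rac
    ... | refl with xs  | Rxs
    ...   | []    | Ryb ∷ _ = contradiction Ryb ¬Ry
    ...   | _ ∷ _ | Ryb ∷ _ = contradiction Ryb ¬Ry
    maximal-chain-unique fun ¬Rx ¬Ry (c ∷ xs) (d ∷ ys) (Rac ∷ Rxs) (Rad ∷ Rys)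
      with fun Rac Rad
    ... | refl = cong (c ∷_) (maximal-chain-unique fun ¬Rx ¬Ry xs ys Rxs Rys)

module _ {A : Set} {_≈_ _⊏_ : Rel A 0ℓ} (spo : IsStrictPartialOrder _≈_ _⊏_) (xs : List A) where

  finite-wellFounded : WellFounded (λ a b → a ∈ₗ xs × a ⊏ b × b ∈ₗ xs)
  finite-wellFounded b = acc λ { (a∈ , _) → accessible (lookup-index a∈)
    (spo-wellFounded (On.isStrictPartialOrder (lookup xs) spo) (index a∈)) }
    where
    accessible : ∀ {a i} → a ≡ lookup xs i → Acc (_⊏_ on lookup xs) i →
                 Acc (λ a b → a ∈ₗ xs × a ⊏ b × b ∈ₗ xs) a
    accessible refl (acc rs) = acc λ { (a∈ , a⊏b , _) →
      accessible (lookup-index a∈) (rs (subst (_⊏ _) (lookup-index a∈) a⊏b)) }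

-- Geometry of the square grid

_≟_ : DecidableEquality Point
_≟_ = ≡-dec ℤ._≟_ ℤ._≟_

open DecMembership _≟_ using (_∈?_)

column : Point → ℤ
column = proj₂

Adjacent : Rel Point 0ℓ
Adjacent p q = p ⊖ q ∈ₗ adjacentOffsets

Even : Pred Point 0ℓ
Even (i , j) = + 2 ∣ i - j

even? : Decidable Even
even? (i , j) = 2 ℕ.∣? ∣ i - j ∣

2∣z⊎2∣z±1 : ∀ z → + 2 ∣ₛ z ⊎ (+ 2 ∣ₛ z + + 1 × + 2 ∣ₛ z + -[1+ 0 ])
2∣z⊎2∣z±1 z with z %ℕ 2 | z /ℕ 2 | n%ℕd<d z 2 | a≡a%ℕn+[a/ℕn]*n z 2
... | 0 | q | _ | refl = inj₁ (divides q (ℤ.+-identityˡ _))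
... | 1 | q | _ | refl = inj₂ (divides (+ 1 + q) (up q) , divides q (down q))
  where
  up : ∀ q → + 1 + q * + 2 + + 1 ≡ (+ 1 + q) * + 2
  up = solve-∀
  down : ∀ q → + 1 + q * + 2 + -[1+ 0 ] ≡ q * + 2
  down = solve-∀
... | ℕ.suc (ℕ.suc _) | _ | s≤s (s≤s ()) | _

difference : ∀ i j k l → i - j ≡ (k - l) + ((i - k) - (j - l))
difference = solve-∀

adjacent-offset : ∀ p q → Adjacent p q →
  let (i , j) = p ; (k , l) = q in
  i - j ≡ (k - l) + + 1 ⊎ i - j ≡ (k - l) + -[1+ 0 ]
adjacent-offset (i , j) (k , l) adj
  with i - k | j - l | adj | difference i j k l
... | _ | _ | here refl                         | e = inj₁ e
... | _ | _ | there (here refl)                 | e = inj₂ e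
... | _ | _ | there (there (here refl))         | e = inj₂ e
... | _ | _ | there (there (there (here refl))) | e = inj₁ e

adjacent⇒¬even² : ∀ p q → Adjacent p q → Even p → ¬ Even q
adjacent⇒¬even² (i , j) (k , l) adj ep eq =
  [ 2∤1 ∘ ∣⇒∣ᵤ ∘ 2∣offset , 2∤1 ∘ ∣⇒∣ᵤ ∘ 2∣offset ]′ (adjacent-offset (i , j) (k , l) adj)
  where
  2∣offset : ∀ {c} → i - j ≡ (k - l) + c → + 2 ∣ₛ c
  2∣offset e = Signed.∣m+n∣m⇒∣n (subst (+ 2 ∣ₛ_) e (∣ᵤ⇒∣ ep)) (∣ᵤ⇒∣ {+ 2} {k - l} eq)
  2∤1 : ¬ 2 ℕ.∣ 1
  2∤1 = ℕ.>⇒∤ (s≤s (s≤s z≤n))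

adjacent⇒even : ∀ p q → Adjacent p q → ¬ Even q → Even p
adjacent⇒even (i , j) (k , l) adj ¬eq
  with 2∣z⊎2∣z±1 (k - l) | adjacent-offset (i , j) (k , l) adj
... | inj₁ 2∣q        | _      = contradiction (∣⇒∣ᵤ 2∣q) ¬eq
... | inj₂ (2∣q+1 , _) | inj₁ e = ∣⇒∣ᵤ (subst (+ 2 ∣ₛ_) (sym e) 2∣q+1)
... | inj₂ (_ , 2∣q-1) | inj₂ e = ∣⇒∣ᵤ (subst (+ 2 ∣ₛ_) (sym e) 2∣q-1)

neg-minus : ∀ i k → - (i - k) ≡ k - i
neg-minus = solve-∀

adjacent-sym : ∀ p q → Adjacent p q → Adjacent q p
adjacent-sym (i , j) (k , l) adj
  with subst₂ (λ u v → (u , v) ∈ₗ map negate adjacentOffsets) (neg-minus i k) (neg-minus j l)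
              (∈-map⁺ negate adj)
  where
  negate : Point → Point
  negate (u , v) = - u , - v
... | here e                         = there (here e)
... | there (here e)                 = here e
... | there (there (here e))         = there (there (there (here e)))
... | there (there (there (here e))) = there (there (here e))

-- The offsets b ⊖ a and a ⊖ left b determine each other: each is the image of
-- the other under this involution.
turn : Point → Point
turn (u , v) = - u , + 1 - v

turn-left : ∀ a b → turn (a ⊖ left b) ≡ b ⊖ a
turn-left (i , j) (k , l) = cong₂ _,_ (x i k) (y j l)
  where
  x : ∀ i k → - (i - (k - + 0)) ≡ k - i
  x = solve-∀
  y : ∀ j l → + 1 - (j - (l - + 1)) ≡ l - j
  y = solve-∀

turn-step : ∀ a b → turn (b ⊖ a) ≡ a ⊖ left b
turn-step (i , j) (k , l) = cong₂ _,_ (x i k) (y j l)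
  where
  x : ∀ i k → - (k - i) ≡ i - (k - + 0)
  x = solve-∀
  y : ∀ j l → + 1 - (l - j) ≡ j - (l - + 1)
  y = solve-∀

⊖≡0⇒≡ : ∀ a b → b ⊖ a ≡ (+ 0 , + 0) → a ≡ b
⊖≡0⇒≡ a b e = cong₂ _,_
  (sym (ℤ.i-j≡0⇒i≡j _ _ (cong proj₁ e))) (sym (ℤ.i-j≡0⇒i≡j _ _ (cong proj₂ e)))

adjacent-left⇒step : ∀ a b → Adjacent a (left b) → a ≡ b ⊎ Step a b
adjacent-left⇒step a b adj
  with subst (_∈ₗ map turn adjacentOffsets) (turn-left a b) (∈-map⁺ turn adj)
... | here e                         = inj₂ (there (there (here e)))
... | there (here e)                 = inj₂ (here e)
... | there (there (here e))         = inj₁ (⊖≡0⇒≡ a b e)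
... | there (there (there (here e))) = inj₂ (there (here e))

step⇒adjacent-left : ∀ a b → Step a b → Adjacent a (left b)
step⇒adjacent-left a b st
  with subst (_∈ₗ map turn steps) (turn-step a b) (∈-map⁺ turn st)
... | here e                 = there (here e)
... | there (here e)         = there (there (there (here e)))
... | there (there (here e)) = here e

left-adjacent : ∀ b → Adjacent (left b) b
left-adjacent (k , l) = there (there (there (here (cong₂ _,_ (x k) (y l)))))
  where
  x : ∀ k → (k - + 0) - k ≡ + 0
  x = solve-∀
  y : ∀ l → (l - + 1) - l ≡ -[1+ 0 ]
  y = solve-∀

right : Point → Point
right (k , l) = k , l + + 1

left-right : ∀ p → left (right p) ≡ p
left-right (k , l) = cong₂ _,_ (x k) (y l)
  where
  x : ∀ k → k - + 0 ≡ k
  x = solve-∀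
  y : ∀ l → l + + 1 - + 1 ≡ l
  y = solve-∀

right-left : ∀ p → right (left p) ≡ p
right-left (k , l) = cong₂ _,_ (x k) (y l)
  where
  x : ∀ k → k - + 0 ≡ k
  x = solve-∀
  y : ∀ l → l - + 1 + + 1 ≡ l
  y = solve-∀

left-injective : ∀ p q → left p ≡ left q → p ≡ q
left-injective p q e = trans (sym (right-left p)) (trans (cong right e) (right-left q))

step⇒column< : ∀ a b → Step a b → column a < column b
step⇒column< (i , j) (k , l) st = subst₂ _<_ (ℤ.+-identityʳ j) (y j l) (+-monoʳ-< j (positive st))
  where
  y : ∀ j l → j + (l - j) ≡ l
  y = solve-∀
  positive : ∀ {p} → p ∈ₗ steps → + 0 < column p
  positive (here refl)                 = +<+ (s≤s z≤n)
  positive (there (here refl))         = +<+ (s≤s z≤n)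
  positive (there (there (here refl))) = +<+ (s≤s z≤n)

step⇒≢ : ∀ a b → Step a b → a ≢ b
step⇒≢ a b st refl = <-irrefl refl (step⇒column< a b st)

step-even : ∀ a b → Step a b → Even a → Even b
step-even a b st ea = adjacent⇒even b (left b) (adjacent-sym (left b) b (left-adjacent b))
  (adjacent⇒¬even² a (left b) (step⇒adjacent-left a b st) ea)

linked-step⇒unique : ∀ {ps} → Linked Step ps → Unique ps
linked-step⇒unique =
  AllPairs.map (λ { p<p refl → <-irrefl refl p<p }) ∘
  Linked⇒AllPairs {R = λ p q → column p < column q} <-trans ∘
  Linked.map (λ {p} {q} → step⇒column< p q)

-- Dominoes

squares-pair : ∀ d {p q r} → p ≢ q → p ∈ squares d → q ∈ squares d → r ∈ squares d →
               r ≡ p ⊎ r ≡ q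
squares-pair d p≢q (inj₁ refl) (inj₁ refl) _           = contradiction refl p≢q
squares-pair d p≢q (inj₁ refl) (inj₂ refl) r∈          = r∈
squares-pair d p≢q (inj₂ refl) (inj₁ refl) (inj₁ refl) = inj₂ refl
squares-pair d p≢q (inj₂ refl) (inj₁ refl) (inj₂ refl) = inj₁ refl
squares-pair d p≢q (inj₂ refl) (inj₂ refl) _           = contradiction refl p≢q

≈ᵈ-pair : ∀ d d′ {p q} → p ≢ q → p ∈ squares d → q ∈ squares d →
          p ∈ squares d′ → q ∈ squares d′ → d ≈ᵈ d′
≈ᵈ-pair d d′ p≢q p∈d q∈d p∈d′ q∈d′ =
  (λ r∈d  → [ (λ { refl → p∈d′ }) , (λ { refl → q∈d′ }) ]′ (squares-pair d p≢q p∈d q∈d r∈d)) ,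
  (λ r∈d′ → [ (λ { refl → p∈d }) , (λ { refl → q∈d }) ]′ (squares-pair d′ p≢q p∈d′ q∈d′ r∈d′))

squares-other-unique : ∀ d {p q r} → p ≢ r → q ≢ r →
  p ∈ squares d → q ∈ squares d → r ∈ squares d → p ≡ q
squares-other-unique d p≢r q≢r p∈ q∈ r∈ with squares-pair d p≢r p∈ r∈ q∈
... | inj₁ q≡p = sym q≡p
... | inj₂ q≡r = contradiction q≡r q≢r

squares-other : ∀ d {p} → p ∈ squares d → ∃[ q ] q ∈ squares d × Adjacent p q
squares-other d (inj₁ refl) = Domino.t d , inj₂ refl , Domino.adjacent d
squares-other d (inj₂ refl) = Domino.s d , inj₁ refl ,
  adjacent-sym (Domino.s d) (Domino.t d) (Domino.adjacent d)

adjacent⇒≢ : ∀ p q → Adjacent p q → p ≢ q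
adjacent⇒≢ p q adj refl = ¬even (adjacent⇒even p p adj ¬even)
  where
  ¬even : ¬ Even p
  ¬even e = adjacent⇒¬even² p p adj e e

module Colours (S : Pred Point 0ℓ) where

  W⇒¬even : ∀ {w} → w ∈ W S → ¬ Even w
  W⇒¬even (w∈S , w∉B) even = w∉B (w∈S , even)

  ¬even⇒W : ∀ {w} → w ∈ S → ¬ Even w → w ∈ W S
  ¬even⇒W w∈S ¬even = w∈S , ¬even ∘ proj₂

  left∈W : ∀ b → left b ∈ S → Even b → left b ∈ W S
  left∈W b lb∈S even = ¬even⇒W lb∈S λ e → adjacent⇒¬even² (left b) b (left-adjacent b) e even

  left∈W⇒even : ∀ b → left b ∈ W S → Even b
  left∈W⇒even b lb∈W =
    adjacent⇒even b (left b) (adjacent-sym (left b) b (left-adjacent b)) (W⇒¬even lb∈W)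

  X⇒∉S : ∀ {x} → x ∈ X S → x ∉ S
  X⇒∉S {x} (x∉B , lx∈W) x∈S = x∉B (x∈S , left∈W⇒even x lx∈W)

  module _ {q : List Point} (path : IsPath S q) where
    open IsPath path

    path-successor : ∀ {a} → a ∈ₗ q → a ∈ B S → ∃[ b ] Consecutive a b q
    path-successor a∈q a∈B rewrite shape with successor (start ∷ intermediate) a∈q
    ... | inj₁ refl = contradiction a∈B (proj₁ end∈X)
    ... | inj₂ next = next

    path-predecessor : ∀ {b} → b ∈ₗ q → left b ∈ W S → ∃[ a ] Consecutive a b q
    path-predecessor b∈q lb∈W rewrite shape with predecessor b∈q
    ... | inj₁ refl     = contradiction lb∈W (proj₂ start∈E)
    ... | inj₂ previous = previous

    path-consecutive : ∀ {a b} → Consecutive a b q → a ∈ B S × left b ∈ W S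
    path-consecutive c rewrite shape =
      All.lookup {P = B S} (proj₁ start∈E ∷ All.map proj₁ all∈I)
        (consecutive⇒∈-init (start ∷ intermediate) c) ,
      All.lookup {P = λ b → left b ∈ W S} (All.∷ʳ⁺ (All.map proj₂ all∈I) (proj₂ end∈X))
        (consecutive⇒∈-tail c)

module Decision {S : Pred Point 0ℓ} (finite : Finite S) where

  points : List Point
  points = proj₁ finite

  S⇒∈points : ∀ {p} → p ∈ S → p ∈ₗ points
  S⇒∈points = proj₁ (proj₂ finite)

  S? : Decidable S
  S? p = map′ (proj₂ (proj₂ finite)) S⇒∈points (p ∈? points)

  B? : Decidable (B S)
  B? p = S? p ×-dec even? p

  W? : Decidable (W S)
  W? p = S? p ×-dec ¬? (B? p)

  E? : Decidable (E S)
  E? p = B? p ×-dec ¬? (W? (left p))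

-- From tilings to path families

module FromTiling {S : Pred Point 0ℓ} (finite : Finite S) (T : Tiling S) where
  open Tiling T
  open Colours S
  open Decision finite

  infix 4 _⟶_

  record _⟶_ (a b : Point) : Set where
    field
      step     : Step a b
      d        : Domino
      d∈T      : d ∈ dominoes
      a∈d      : a ∈ squares d
      left-b∈d : left b ∈ squares d

    a≢left-b : a ≢ left b
    a≢left-b = adjacent⇒≢ a (left b) (step⇒adjacent-left a b step)

    a∈S : a ∈ S
    a∈S = inside d d∈T a∈d

    left-b∈S : left b ∈ S
    left-b∈S = inside d d∈T left-b∈d

  open _⟶_

  WithLeft : Pred Point 0ℓ
  WithLeft b = ∃[ d ] d ∈ dominoes × b ∈ squares d × left b ∈ squares d

  ⟶-functional : ∀ {a b b′} → a ⟶ b → a ⟶ b′ → b ≡ b′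
  ⟶-functional {a} r r′ = left-injective _ _ (squares-other-unique (d r)
    (a≢left-b r ∘ sym) (a≢left-b r′ ∘ sym) (left-b∈d r)
    (proj₂ (disjoint (d r) (d r′) a (d∈T r) (d∈T r′) (a∈d r) (a∈d r′)) (left-b∈d r′)) (a∈d r))

  ⟶-injective : ∀ {a a′ b} → a ⟶ b → a′ ⟶ b → a ≡ a′
  ⟶-injective {b = b} r r′ = squares-other-unique (d r) (a≢left-b r) (a≢left-b r′) (a∈d r)
    (proj₂ (disjoint (d r) (d r′) (left b) (d∈T r) (d∈T r′) (left-b∈d r) (left-b∈d r′)) (a∈d r′))
    (left-b∈d r)

  ⟶⇒¬withLeftˡ : ∀ {a b} → a ⟶ b → ¬ WithLeft a
  ⟶⇒¬withLeftˡ {a} {b} r (d′ , d′∈T , a∈d′ , left-a∈d′) =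
    step⇒≢ a b (step r) (left-injective _ _ (squares-other-unique (d r)
      (adjacent⇒≢ (left a) a (left-adjacent a)) (a≢left-b r ∘ sym)
      (proj₂ (disjoint (d r) d′ a (d∈T r) d′∈T (a∈d r) a∈d′) left-a∈d′) (left-b∈d r) (a∈d r)))

  ⟶⇒¬withLeftʳ : ∀ {a b} → a ⟶ b → ¬ WithLeft b
  ⟶⇒¬withLeftʳ {a} {b} r (d′ , d′∈T , b∈d′ , left-b∈d′) =
    step⇒≢ a b (step r) (squares-other-unique (d r)
      (a≢left-b r) (adjacent⇒≢ (left b) b (left-adjacent b) ∘ sym) (a∈d r)
      (proj₂ (disjoint (d r) d′ (left b) (d∈T r) d′∈T (left-b∈d r) left-b∈d′) b∈d′) (left-b∈d r))

  ⟶-next : ∀ a → a ∈ B S → WithLeft a ⊎ ∃[ b ] a ⟶ b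
  ⟶-next a (a∈S , _) with covers a a∈S
  ... | d , d∈T , a∈d with squares-other d a∈d
  ... | w , w∈d , adj
    with adjacent-left⇒step a (right w) (subst (Adjacent a) (sym (left-right w)) adj)
  ... | inj₁ refl = inj₁ (d , d∈T , a∈d , subst (_∈ squares d) (sym (left-right w)) w∈d)
  ... | inj₂ st   = inj₂ (right w , record
    { step = st ; d = d ; d∈T = d∈T ; a∈d = a∈d
    ; left-b∈d = subst (_∈ squares d) (sym (left-right w)) w∈d })

  ⟶-previous : ∀ b → left b ∈ W S → WithLeft b ⊎ ∃[ a ] a ∈ B S × a ⟶ b
  ⟶-previous b lb∈W@(lb∈S , _) with covers (left b) lb∈S
  ... | d , d∈T , lb∈d with squares-other d lb∈d
  ... | a , a∈d , adj with adjacent-left⇒step a b (adjacent-sym (left b) a adj)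
  ... | inj₁ refl = inj₁ (d , d∈T , a∈d , lb∈d)
  ... | inj₂ st   = inj₂ (a ,
    (inside d d∈T a∈d , adjacent⇒even a (left b) (adjacent-sym (left b) a adj) (W⇒¬even lb∈W)) ,
    record { step = st ; d = d ; d∈T = d∈T ; a∈d = a∈d ; left-b∈d = lb∈d })

  X⇒¬⟶ : ∀ {x b} → x ∈ X S → ¬ (x ⟶ b)
  X⇒¬⟶ x∈X r = X⇒∉S x∈X (a∈S r)

  E⇒¬⟶ : ∀ {e a} → e ∈ E S → ¬ (a ⟶ e)
  E⇒¬⟶ {e} ((_ , even) , le∉W) r = le∉W (left∈W e (left-b∈S r) even)

  record Tail (a : Point) (t : List Point) : Set where
    field
      intermediate : List Point
      end          : Point
      shape        : t ≡ intermediate ∷ʳ end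
      all∈I        : All (I S) intermediate
      end∈X        : end ∈ X S
      linked       : Linked _⟶_ (a ∷ t)

  first : ∀ {a t} → Tail a t → ∃[ b ] a ⟶ b
  first record { intermediate = []    ; shape = refl ; linked = r ∷ _ } = _ , r
  first record { intermediate = _ ∷ _ ; shape = refl ; linked = r ∷ _ } = _ , r

  extend : ∀ {a b t} → a ⟶ b → b ∈ I S → Tail b t → Tail a (b ∷ t)
  extend {b = b} r b∈I tl = record
    { intermediate = b ∷ intermediate
    ; end          = end
    ; shape        = cong (b ∷_) shape
    ; all∈I        = b∈I ∷ all∈I
    ; end∈X        = end∈X
    ; linked       = r ∷ linked
    } where open Tail tl

  _≺_ _≻_ : Rel Point 0ℓ
  a ≺ b = a ∈ₗ points × column a < column b × b ∈ₗ points
  a ≻ b = a ∈ₗ points × column b < column a × b ∈ₗ points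

  ≺-wellFounded : WellFounded _≺_
  ≺-wellFounded = finite-wellFounded (On.isStrictPartialOrder column <-isStrictPartialOrder) points

  ≻-wellFounded : WellFounded _≻_
  ≻-wellFounded = finite-wellFounded
    (Flip.isStrictPartialOrder (On.isStrictPartialOrder column <-isStrictPartialOrder)) points

  forward : ∀ {a b} → Acc _≻_ a → a ∈ B S → a ⟶ b → ∃[ t ] Tail a t
  forward {a} {b} (acc rs) (a∈S , even) r with S? b
  ... | no b∉S = b ∷ [] , record
    { intermediate = [] ; end = b ; shape = refl ; all∈I = []
    ; end∈X = b∉S ∘ proj₁ , left∈W b (left-b∈S r) (step-even a b (step r) even)
    ; linked = r ∷ [-] }
  ... | yes b∈S with ⟶-next b (b∈S , step-even a b (step r) even)
  ...   | inj₁ withLeft = contradiction withLeft (⟶⇒¬withLeftʳ r)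
  ...   | inj₂ (c , r′) = b ∷ proj₁ rest ,
    extend r (b∈B , left∈W b (left-b∈S r) (proj₂ b∈B)) (proj₂ rest)
    where
    b∈B : b ∈ B S
    b∈B = b∈S , step-even a b (step r) even
    rest = forward (rs (S⇒∈points b∈S , step⇒column< a b (step r) , S⇒∈points a∈S)) b∈B r′

  pathsᵀ : Pred (List Point) 0ℓ
  pathsᵀ q = IsPath S q × Linked _⟶_ q

  backward : ∀ {a t} → Acc _≺_ a → a ∈ B S → Tail a t → ∃[ q ] q ∈ pathsᵀ × (a ∷ t) ⊆ₗ q
  backward {a} {t} (acc rs) a∈B tl with S? (left a)
  ... | no la∉S = a ∷ t , (record
    { start = a ; intermediate = intermediate ; end = end ; shape = cong (a ∷_) shape
    ; start∈E = a∈B , la∉S ∘ proj₁ ; all∈I = all∈I ; end∈X = end∈X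
    ; linked = Linked.map step linked } , linked) , λ p∈ → p∈
    where open Tail tl
  ... | yes la∈S with ⟶-previous a (left∈W a la∈S (proj₂ a∈B))
  ...   | inj₁ withLeft = contradiction withLeft (⟶⇒¬withLeftˡ (proj₂ (first tl)))
  ...   | inj₂ (a′ , a′∈B , r)
    with backward (rs (S⇒∈points (proj₁ a′∈B) , step⇒column< a′ a (step r) , S⇒∈points (proj₁ a∈B)))
                  a′∈B (extend r (a∈B , left∈W a la∈S (proj₂ a∈B)) tl)
  ...     | q , q∈ , ⊆q = q , q∈ , ⊆q ∘ there

  path-through : ∀ {a b} → a ∈ B S → a ⟶ b → ∃[ q ] q ∈ pathsᵀ × a ∈ₗ q
  path-through a∈B r with forward (≻-wellFounded _) a∈B r
  ... | t , tl with backward (≺-wellFounded _) a∈B tl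
  ... | q , q∈ , ⊆q = q , q∈ , ⊆q (here refl)

  entriesᵀ : ∀ e → e ∈ E S → ∃[ ps ] e ∷ ps ∈ pathsᵀ
  entriesᵀ e e∈E@(e∈B , le∉W) with ⟶-next e e∈B
  ... | inj₁ (d , d∈T , _ , le∈d) = contradiction (left∈W e (inside d d∈T le∈d) (proj₂ e∈B)) le∉W
  ... | inj₂ (_ , r) with path-through e∈B r
  ... | [] , _ , ()
  ... | h ∷ t , q∈ , e∈q with predecessor e∈q
  ... | inj₁ refl    = t , q∈
  ... | inj₂ (_ , c) = contradiction (linked⇒consecutive (proj₂ q∈) c) (E⇒¬⟶ e∈E)

  exitsᵀ : ∀ x → x ∈ X S → ∃[ ps ] ps ∷ʳ x ∈ pathsᵀ
  exitsᵀ x x∈X with ⟶-previous x (proj₂ x∈X)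
  ... | inj₁ (d , d∈T , x∈d , _) = contradiction (inside d d∈T x∈d) (X⇒∉S x∈X)
  ... | inj₂ (b , b∈B , r) with path-through b∈B r
  ... | _ , (path@record { shape = refl } , linked) , b∈q with path-successor path b∈q b∈B
  ... | c , bc with ⟶-functional (linked⇒consecutive linked bc) r
  ... | refl with IsPath.shape path
  ... | refl with successor (IsPath.start path ∷ IsPath.intermediate path) (consecutive⇒∈ʳ bc)
  ... | inj₁ refl    = IsPath.start path ∷ IsPath.intermediate path , path , linked
  ... | inj₂ (_ , c) = contradiction (linked⇒consecutive linked c) (X⇒¬⟶ x∈X)

  atMostOneᵀ : ∀ p ps qs → ps ∈ pathsᵀ → qs ∈ pathsᵀ → p ∈ₗ ps → p ∈ₗ qs → ps ≡ qs
  atMostOneᵀ p _ _ (path@record { shape = refl } , lp) (path′@record { shape = refl } , lq)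
             p∈ps p∈qs
    with predecessor (head∈chain ⟶-injective (E⇒¬⟶ (IsPath.start∈E path′)) lp lq p∈ps p∈qs)
  ... | inj₁ refl = cong (_ ∷_) (maximal-chain-unique ⟶-functional
    (X⇒¬⟶ (IsPath.end∈X path)) (X⇒¬⟶ (IsPath.end∈X path′)) _ _ lp lq)
  ... | inj₂ (_ , c) = contradiction (linked⇒consecutive lq c) (E⇒¬⟶ (IsPath.start∈E path))

  family : PathFamily S
  family = record
    { paths     = pathsᵀ
    ; isPath    = λ _ → proj₁
    ; entries   = entriesᵀ
    ; exits     = exitsᵀ
    ; atMostOne = atMostOneᵀ
    }

-- From path families to tilings

module FromFamily {S : Pred Point 0ℓ} (finite : Finite S) (P : PathFamily S) where
  open PathFamily P
  open Colours S
  open Decision finite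

  OnPath : Pred Point 0ℓ
  OnPath a = ∃[ q ] q ∈ paths × a ∈ₗ q

  onPath? : Decidable OnPath
  onPath? a = map′ fromStart toStart (any? throughFrom? points)
    where
    ThroughFrom : Pred Point 0ℓ
    ThroughFrom e = ∃[ t ] e ∷ t ∈ paths × a ∈ₗ (e ∷ t)

    throughFrom? : Decidable ThroughFrom
    throughFrom? e with E? e
    ... | no e∉E = no λ (_ , q∈ , _) → e∉E (start-of q∈)
      where
      start-of : ∀ {t} → e ∷ t ∈ paths → e ∈ E S
      start-of q∈ with isPath _ q∈
      ... | record { shape = refl ; start∈E = e∈E } = e∈E
    ... | yes e∈E with entries e e∈E
    ...   | t , q∈ = map′ (λ a∈ → t , q∈ , a∈)
      (λ (t′ , q′∈ , a∈) → subst (a ∈ₗ_) (atMostOne e _ _ q′∈ q∈ (here refl) (here refl)) a∈)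
      (a ∈? (e ∷ t))

    fromStart : Any ThroughFrom points → OnPath a
    fromStart any with find any
    ... | e , _ , t , q∈ , a∈ = e ∷ t , q∈ , a∈

    toStart : OnPath a → Any ThroughFrom points
    toStart (q , q∈ , a∈) with isPath q q∈
    ... | record { shape = refl ; start∈E = (e∈S , _) , _ } = lose (S⇒∈points e∈S) (_ , q∈ , a∈)

  infix 4 _∼_

  data _∼_ (a w : Point) : Set where
    onPath  : ∀ {b q} → q ∈ paths → Consecutive a b q → left b ≡ w → a ∼ w
    offPath : a ∈ I S → ¬ OnPath a → left a ≡ w → a ∼ w

  ∼⇒B : ∀ {a w} → a ∼ w → a ∈ B S
  ∼⇒B (onPath q∈ c _)    = proj₁ (path-consecutive (isPath _ q∈) c)
  ∼⇒B (offPath a∈I _ _) = proj₁ a∈I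

  ∼⇒W : ∀ {a w} → a ∼ w → w ∈ W S
  ∼⇒W (onPath q∈ c refl)    = proj₂ (path-consecutive (isPath _ q∈) c)
  ∼⇒W (offPath a∈I _ refl) = proj₂ a∈I

  B-W-disjoint : ∀ {a w} → a ∈ B S → w ∈ W S → a ≢ w
  B-W-disjoint a∈B w∈W refl = W⇒¬even w∈W (proj₂ a∈B)

  ∼⇒≢ : ∀ {a w} → a ∼ w → a ≢ w
  ∼⇒≢ a∼w = B-W-disjoint (∼⇒B a∼w) (∼⇒W a∼w)

  path-unique : ∀ {q} → q ∈ paths → Unique q
  path-unique q∈ = linked-step⇒unique (IsPath.linked (isPath _ q∈))

  ∼-functional : ∀ {a w w′} → a ∼ w → a ∼ w′ → w ≡ w′
  ∼-functional {a} (onPath q∈ c refl) (onPath q′∈ c′ refl)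
    with atMostOne a _ _ q∈ q′∈ (consecutive⇒∈ˡ c) (consecutive⇒∈ˡ c′)
  ... | refl = cong left (consecutive-functional (path-unique q∈) c c′)
  ∼-functional (onPath q∈ c _) (offPath _ ¬on _) = contradiction (_ , q∈ , consecutive⇒∈ˡ c) ¬on
  ∼-functional (offPath _ ¬on _) (onPath q∈ c _) = contradiction (_ , q∈ , consecutive⇒∈ˡ c) ¬on
  ∼-functional (offPath _ _ refl) (offPath _ _ refl) = refl

  ∼-injective : ∀ {a a′ w} → a ∼ w → a′ ∼ w → a ≡ a′
  ∼-injective (onPath {b} q∈ c refl) (onPath {b′} q′∈ c′ e) with left-injective b′ b e
  ... | refl with atMostOne b _ _ q∈ q′∈ (consecutive⇒∈ʳ c) (consecutive⇒∈ʳ c′)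
  ...   | refl = consecutive-injective (path-unique q∈) c c′
  ∼-injective {a′ = a′} (onPath {b} q∈ c refl) (offPath _ ¬on e) with left-injective a′ b e
  ... | refl = contradiction (_ , q∈ , consecutive⇒∈ʳ c) ¬on
  ∼-injective {a} (offPath _ ¬on e) (onPath {b} q∈ c refl) with left-injective a b e
  ... | refl = contradiction (_ , q∈ , consecutive⇒∈ʳ c) ¬on
  ∼-injective {a} {a′} (offPath _ _ refl) (offPath _ _ e) = sym (left-injective a′ a e)

  dominoesᴾ : Pred Domino 0ℓ
  dominoesᴾ d = ∃[ a ] ∃[ w ] a ∼ w × a ∈ squares d × w ∈ squares d

  consecutiveDomino : ∀ {a b q} → q ∈ paths → Consecutive a b q →
    ∃[ d ] d ∈ dominoesᴾ × a ∈ squares d × left b ∈ squares d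
  consecutiveDomino {a} {b} q∈ c =
    domino a (left b)
      (step⇒adjacent-left a b (linked⇒consecutive (IsPath.linked (isPath _ q∈)) c)) ,
    (a , left b , onPath q∈ c refl , inj₁ refl , inj₂ refl) , inj₁ refl , inj₂ refl

  leftDomino : ∀ {a} → a ∈ I S → ¬ OnPath a →
    ∃[ d ] d ∈ dominoesᴾ × a ∈ squares d × left a ∈ squares d
  leftDomino {a} a∈I ¬on =
    domino a (left a) (adjacent-sym (left a) a (left-adjacent a)) ,
    (a , left a , offPath a∈I ¬on refl , inj₁ refl , inj₂ refl) , inj₁ refl , inj₂ refl

  insideᴾ : ∀ d → d ∈ dominoesᴾ → squares d ⊆ S
  insideᴾ d (a , w , a∼w , a∈d , w∈d) p∈d with squares-pair d (∼⇒≢ a∼w) a∈d w∈d p∈d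
  ... | inj₁ refl = proj₁ (∼⇒B a∼w)
  ... | inj₂ refl = proj₁ (∼⇒W a∼w)

  covers-black : ∀ a → a ∈ B S → ∃[ d ] d ∈ dominoesᴾ × a ∈ squares d
  covers-black a a∈B with onPath? a
  ... | yes (q , q∈ , a∈q) with path-successor (isPath q q∈) a∈q a∈B
  ...   | b , c with consecutiveDomino q∈ c
  ...     | d , d∈ , a∈d , _ = d , d∈ , a∈d
  covers-black a a∈B | no ¬on with W? (left a)
  ...   | no la∉W with entries a (a∈B , la∉W)
  ...     | t , q∈ = contradiction (a ∷ t , q∈ , here refl) ¬on
  covers-black a a∈B | no ¬on | yes la∈W with leftDomino (a∈B , la∈W) ¬on
  ...     | d , d∈ , a∈d , _ = d , d∈ , a∈d

  covers-left : ∀ b → left b ∈ W S → ∃[ d ] d ∈ dominoesᴾ × left b ∈ squares d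
  covers-left b lb∈W = cases (onPath? b) (B? b)
    where
    cases : Dec (OnPath b) → Dec (b ∈ B S) → ∃[ d ] d ∈ dominoesᴾ × left b ∈ squares d
    cases (yes (q , q∈ , b∈q)) _ with path-predecessor (isPath q q∈) b∈q lb∈W
    ... | a , c with consecutiveDomino q∈ c
    ...   | d , d∈ , _ , lb∈d = d , d∈ , lb∈d
    cases (no ¬on) (yes b∈B) with leftDomino (b∈B , lb∈W) ¬on
    ... | d , d∈ , _ , lb∈d = d , d∈ , lb∈d
    cases (no ¬on) (no b∉B) with exits b (b∉B , lb∈W)
    ... | t , q∈ = contradiction (t ∷ʳ b , q∈ , ++⁺ʳ t (here refl)) ¬on

  coversᴾ : ∀ p → p ∈ S → ∃[ d ] d ∈ dominoesᴾ × p ∈ squares d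
  coversᴾ p p∈S with even? p
  ... | yes even = covers-black p (p∈S , even)
  ... | no ¬even = subst (λ p → ∃[ d ] d ∈ dominoesᴾ × p ∈ squares d) (left-right p)
    (covers-left (right p) (subst (W S) (sym (left-right p)) (¬even⇒W p∈S ¬even)))

  disjointᴾ : ∀ d d′ p → d ∈ dominoesᴾ → d′ ∈ dominoesᴾ →
              p ∈ squares d → p ∈ squares d′ → d ≈ᵈ d′
  disjointᴾ d d′ p (a , w , a∼w , a∈d , w∈d) (a′ , w′ , a′∼w′ , a′∈d′ , w′∈d′) p∈d p∈d′
    with squares-pair d (∼⇒≢ a∼w) a∈d w∈d p∈d | squares-pair d′ (∼⇒≢ a′∼w′) a′∈d′ w′∈d′ p∈d′
  ... | inj₁ refl | inj₂ refl = contradiction refl (B-W-disjoint (∼⇒B a∼w) (∼⇒W a′∼w′))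
  ... | inj₂ refl | inj₁ refl = contradiction refl (B-W-disjoint (∼⇒B a′∼w′) (∼⇒W a∼w))
  ... | inj₁ refl | inj₁ refl with ∼-functional a∼w a′∼w′
  ...   | refl = ≈ᵈ-pair d d′ (∼⇒≢ a∼w) a∈d w∈d a′∈d′ w′∈d′
  disjointᴾ d d′ p (a , w , a∼w , a∈d , w∈d) (a′ , w′ , a′∼w′ , a′∈d′ , w′∈d′) p∈d p∈d′
      | inj₂ refl | inj₂ refl with ∼-injective a∼w a′∼w′
  ...   | refl = ≈ᵈ-pair d d′ (∼⇒≢ a∼w) a∈d w∈d a′∈d′ w′∈d′

  tiling : Tiling S
  tiling = record
    { dominoes = dominoesᴾ
    ; respects = λ (d⊆d′ , _) (a , w , a∼w , a∈d , w∈d) → a , w , a∼w , d⊆d′ a∈d , d⊆d′ w∈d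
    ; inside   = insideᴾ
    ; covers   = coversᴾ
    ; disjoint = disjointᴾ
    }

module _ {S : Pred Point 0ℓ} where

  tiling-maximal : (T T′ : Tiling S) →
    Tiling.dominoes T ⊆ Tiling.dominoes T′ → Tiling.dominoes T′ ⊆ Tiling.dominoes T
  tiling-maximal T T′ T⊆T′ {d′} d′∈
    with Tiling.covers T (Domino.s d′) (Tiling.inside T′ d′ d′∈ (inj₁ refl))
  ... | d , d∈ , p∈d =
    Tiling.respects T (Tiling.disjoint T′ d d′ (Domino.s d′) (T⊆T′ d∈) d′∈ p∈d (inj₁ refl)) d∈

  family-maximal : (P P′ : PathFamily S) →
    PathFamily.paths P ⊆ PathFamily.paths P′ → PathFamily.paths P′ ⊆ PathFamily.paths P
  family-maximal P P′ P⊆P′ {q} q∈ with PathFamily.isPath P′ q q∈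
  ... | path@record { shape = refl }
    with PathFamily.entries P (IsPath.start path) (IsPath.start∈E path)
  ... | t , q′∈ = subst (PathFamily.paths P)
    (PathFamily.atMostOne P′ (IsPath.start path) _ _ (P⊆P′ q′∈) q∈ (here refl) (here refl)) q′∈

module _ {S : Pred Point 0ℓ} (finite : Finite S) where
  open FromTiling finite using (family)
  open FromFamily finite using (tiling)

  family-mono : (T T′ : Tiling S) → Tiling.dominoes T ⊆ Tiling.dominoes T′ →
    PathFamily.paths (family T) ⊆ PathFamily.paths (family T′)
  family-mono T T′ T⊆T′ (path , linked) = path , Linked.map
    (λ r → record { FromTiling._⟶_ r ; d∈T = T⊆T′ (FromTiling._⟶_.d∈T r) }) linked

  tiling-mono : (P P′ : PathFamily S) → PathFamily.paths P ⊆ PathFamily.paths P′ →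
    PathFamily.paths P′ ⊆ PathFamily.paths P →
    Tiling.dominoes (tiling P) ⊆ Tiling.dominoes (tiling P′)
  tiling-mono P P′ P⊆P′ P′⊆P (a , w , a∼w , rest) = a , w , transport a∼w , rest
    where
    open FromFamily finite using (_∼_; onPath; offPath)
    transport : ∀ {a w} → _∼_ P a w → _∼_ P′ a w
    transport (onPath q∈ c e)     = onPath (P⊆P′ q∈) c e
    transport (offPath a∈I ¬on e) = offPath a∈I (λ (q , q∈ , a∈q) → ¬on (q , P′⊆P q∈ , a∈q)) e

  family∘tiling : (P : PathFamily S) → PathFamily.paths P ⊆ PathFamily.paths (family (tiling P))
  family∘tiling P {q} q∈ = path , consecutive⇒linked q arrow
    where
    path = PathFamily.isPath P q q∈
    arrow : ∀ {a b} → Consecutive a b q → FromTiling._⟶_ finite (tiling P) a b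
    arrow c with FromFamily.consecutiveDomino finite P q∈ c
    ... | d , d∈ , a∈d , left-b∈d = record
      { step = linked⇒consecutive (IsPath.linked path) c
      ; d = d ; d∈T = d∈ ; a∈d = a∈d ; left-b∈d = left-b∈d }

  tiling∘family : (T : Tiling S) → Tiling.dominoes (tiling (family T)) ⊆ Tiling.dominoes T
  tiling∘family T {d} (a , w , a∼w , a∈d , w∈d) = covered a∼w w∈d
    where
    open Tiling T
    open FromTiling finite T using (⟶-next; path-through; module _⟶_)
    open FromFamily finite (family T) using (_∼_; onPath; offPath)
    covered : ∀ {w} → a ∼ w → w ∈ squares d → d ∈ dominoes
    covered (onPath (_ , linked) c refl) lb∈d = respects
      (≈ᵈ-pair (_⟶_.d r) d (_⟶_.a≢left-b r) (_⟶_.a∈d r) (_⟶_.left-b∈d r) a∈d lb∈d) (_⟶_.d∈T r)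
      where r = linked⇒consecutive linked c
    covered (offPath (a∈B , _) ¬on refl) la∈d with ⟶-next a a∈B
    ... | inj₁ (d′ , d′∈T , a∈d′ , la∈d′) = respects
      (≈ᵈ-pair d′ d (adjacent⇒≢ (left a) a (left-adjacent a) ∘ sym) a∈d′ la∈d′ a∈d la∈d) d′∈T
    ... | inj₂ (_ , r) = contradiction (path-through a∈B r) ¬on

proposition6p1 : (S : Pred Point 0ℓ) → Finite S →
    Bijection (tilings S) (pathFamilies S)
proposition6p1 S finite = Inverse⇒Bijection record
  { to        = family
  ; from      = tiling
  ; to-cong   = λ {T} {T′} → family-cong T T′
  ; from-cong = λ {P} {P′} → tiling-cong P P′
  ; inverse   =
      strictlyInverseˡ⇒inverseˡ (tilings S) (pathFamilies S) {f = family} {f⁻¹ = tiling}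
        (λ {T} {T′} → family-cong T T′)
        (λ P → family-maximal P (family (tiling P)) (family∘tiling finite P) ,
               family∘tiling finite P)
    , strictlyInverseʳ⇒inverseʳ (tilings S) (pathFamilies S) {f⁻¹ = tiling} {f = family}
        (λ {P} {P′} → tiling-cong P P′)
        (λ T → tiling∘family finite T ,
               tiling-maximal (tiling (family T)) T (tiling∘family finite T))
  }
  where
  open FromTiling finite using (family)
  open FromFamily finite using (tiling)
  open Setoid (tilings S) using () renaming (_≈_ to _≈ᵗ_)
  open Setoid (pathFamilies S) using () renaming (_≈_ to _≈ᶠ_)

  family-cong : ∀ T T′ → T ≈ᵗ T′ → family T ≈ᶠ family T′
  family-cong T T′ (T⊆T′ , T′⊆T) = family-mono finite T T′ T⊆T′ , family-mono finite T′ T T′⊆T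

  tiling-cong : ∀ P P′ → P ≈ᶠ P′ → tiling P ≈ᵗ tiling P′
  tiling-cong P P′ (P⊆P′ , P′⊆P) =
    (λ {d} → tiling-mono finite P P′ P⊆P′ P′⊆P {d}) ,
    (λ {d} → tiling-mono finite P′ P P′⊆P P⊆P′ {d})
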